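{- Let $q=4$ and let $S,T,u_0,u_1,H_1,H_2,G_1,G_2$ be the sets, integers and graphs specified in the context. Then the amalgam graph $B^*_4(S,T,u_0,u_1)$ is a $(\{5,6\};5)$-cage of order $31$.
   Context: All graphs are finite, undirected and simple. The girth of a graph is the length of a shortest cycle. For integers $2\le r<m$, an $(\{r,m\};g)$-graph is a graph of girth exactly $g$ whose set of vertex degrees is exactly $\{r,m\}$, and an $(\{r,m\};g)$-cage is an $(\{r,m\};g)$-graph of minimum possible order. Let $GF(4)=\{0,1,\alpha,\alpha^2\}$ be the field with four elements and $GF^*(4)=GF(4)\setminus\{0\}$. The graph $B_4$ is the bipartite graph with vertex classes $V_0=\{(x,y)_0: x,y\in GF(4)\}$ and $V_1=\{(m,b)_1: m,b\in GF(4)\}$, in which $(x,y)_0$ is adjacent to $(m,b)_1$ if and only if $y=mx+b$. Parameters: $S=\{0\}$, $T=\emptyset$, $u_0=u_1=0$. $H_1$ has vertex set $GF^*(4)$ and edges $\{1,\alpha^2\},\{\alpha^2,\alpha\}$. $G_1$ has vertex set $GF(4)$ and edges $\{0,\alpha\},\{1,\alpha^2\}$. $H_2$ and $G_2$ are both the graph with vertex set $GF(4)$ and edges $\{\alpha^2,0\},\{0,1\},\{1,\alpha\}$. With these parameters, the amalgam $B^*_4(S,T,u_0,u_1)$ is the graph obtained from $B_4$ by deleting the single vertex $(0,0)_0$ (i.e. the vertices $(0,y)_0$ with $y\in S$; nothing else is deleted since $T=\emptyset$ and $u_0=u_1=0$) and then adding the edges: $(0,u)_0(0,v)_0$ for $uv\in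 E(H_1)$; $(0,u)_1(0,v)_1$ for $uv\in E(H_2)$; $(x,u)_0(x,v)_0$ for $x\in GF^*(4)$ and $uv\in E(G_1)$; $(m,u)_1(m,v)_1$ for $m\in GF^*(4)$ and $uv\in E(G_2)$. -}

module Defs where

open import Algebra.Structures using (IsCommutativeRing)
open import Data.Empty using (⊥-elim-irr)
open import Data.Fin using (Fin; toℕ)
open import Data.Irrelevant using ([_])
open import Data.List
  using (List; []; _∷_; _++_; length; filter; cartesianProductWith)
open import Data.List.Membership.Propositional using (_∈_)
open import Data.List.Membership.Propositional.Properties
  using (∈-++⁺ˡ; ∈-++⁺ʳ; ∈-cartesianProductWith⁺)
open import Data.List.Relation.Unary.All using (All; []; _∷_; lookup)
open import Data.List.Relation.Unary.AllPairs using ([]; _∷_)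
open import Data.List.Relation.Unary.Any using (here; there)
open import Data.List.Relation.Unary.Unique.Propositional using (Unique)
open import Data.Nat using (ℕ; suc; _≤_)
open import Data.Product using (∃-syntax; _×_; _,_; uncurry)
open import Data.Product.Properties using (≡-dec)
open import Data.Refinement
  using (Refinement; Refinement-syntax; _,_; value)
open import Data.Sum as Sum using (_⊎_; inj₁; inj₂; swap)
open import Function using (_∘_; id)
open import Function.Bundles using (_⇔_)
open import Function.Definitions using (Injective)
open import Relation.Binary.Definitions
  using (Decidable; DecidableEquality; Irreflexive; Symmetric)
open import Relation.Binary.PropositionalEquality
  using (_≡_; _≢_; refl; sym; cong; cong₂; isEquivalence)
open import Relation.Nullary using (¬_; Dec; yes; no)
open import Relation.Nullary.Decidable
  using (map′; from-yes; ¬?; _×-dec_; _⊎-dec_)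
open import Relation.Nullary.Negation using (contradiction; contradiction-irr)
open import Relation.Unary using (Pred; ｛_｝) renaming (Decidable to Decidable₁)

import Data.List.Membership.DecPropositional as DecMembership
import Data.List.Relation.Unary.Unique.DecPropositional as DecUnique
import Data.Refinement as Refinement

record Graph : Set₁ where
  field
    Vertex   : Set
    Adj      : Vertex → Vertex → Set
    adj?     : Decidable Adj
    symm     : Symmetric Adj
    irrefl   : Irreflexive _≡_ Adj
    -- Finiteness: every vertex is listed exactly once.
    vertices : List Vertex
    complete : ∀ v → v ∈ vertices
    unique   : Unique vertices

  order : ℕ
  order = length vertices

  degree : Vertex → ℕ
  degree v = length (filter (adj? v) vertices)

open Graph
  using ( Vertex; Adj; adj?; symm; irrefl; vertices; complete; unique
        ; order; degree )

record Cycle (G : Graph) (k : ℕ) : Set where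
  field
    3≤k         : 3 ≤ k
    at          : Fin k → Vertex G
    injective   : Injective _≡_ _≡_ at
    consecutive : ∀ i j → toℕ j ≡ suc (toℕ i) → Adj G (at i) (at j)
    closing     : ∀ i j → suc (toℕ i) ≡ k → toℕ j ≡ 0 → Adj G (at i) (at j)

HasGirth : Graph → ℕ → Set
HasGirth G g = Cycle G g × (∀ k → Cycle G k → g ≤ k)

-- ({r,m};g)-graphs.
record IsBiregularGraph (r m g : ℕ) (G : Graph) : Set where
  field
    degrees : ∀ d → (∃[ v ] degree G v ≡ d) ⇔ (d ≡ r ⊎ d ≡ m)
    girth   : HasGirth G g

-- ({r,m};g)-cages.
record IsBiregularCage (r m g : ℕ) (G : Graph) : Set₁ where
  field
    isBiregularGraph : IsBiregularGraph r m g G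
    minimal          : ∀ H → IsBiregularGraph r m g H → order G ≤ order H

module _ {A : Set} {P : A → Set} (P? : Decidable₁ P) where

  refineList : List A → List [ x ∈ A ∣ P x ]
  refineList []       = []
  refineList (x ∷ xs) with P? x
  ... | yes p = (x , [ p ]) ∷ refineList xs
  ... | no  _ = refineList xs

  refineList-complete : ∀ {xs} v → value v ∈ xs → v ∈ refineList xs
  refineList-complete {x ∷ xs} (.x , [ p ]) (here refl) with P? x
  ... | yes _ = here refl
  ... | no ¬p = contradiction-irr p ¬p
  refineList-complete {x ∷ xs} v (there v∈xs) with P? x
  ... | yes _ = there (refineList-complete v v∈xs)
  ... | no  _ = refineList-complete v v∈xs

  refineList-fresh : ∀ {x} .{p : P x} {xs} → All (x ≢_) xs →
                     All ((x , [ p ]) ≢_) (refineList xs)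
  refineList-fresh {xs = []}     []         = []
  refineList-fresh {xs = y ∷ _} (x≢y ∷ x#) with P? y
  ... | yes _ = x≢y ∘ cong value ∷ refineList-fresh x#
  ... | no  _ = refineList-fresh x#

  refineList-unique : ∀ {xs} → Unique xs → Unique (refineList xs)
  refineList-unique {[]}     []        = []
  refineList-unique {x ∷ _} (x# ∷ xs!) with P? x
  ... | yes _ = refineList-fresh x# ∷ refineList-unique xs!
  ... | no  _ = refineList-unique xs!

module _ {V : Set} (_≟_ : DecidableEquality V)
         (vs : List V) (complete : ∀ v → v ∈ vs) (unique : Unique vs) where

  open DecMembership (≡-dec _≟_ _≟_) using (_∈?_)

  fromEdges : (E : List (V × V)) → All (uncurry _≢_) E → Graph
  fromEdges E loopless = record
    { Vertex   = V
    ; Adj      = λ u v → (u , v) ∈ E ⊎ (v , u) ∈ E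
    ; adj?     = λ u v → ((u , v) ∈? E) ⊎-dec ((v , u) ∈? E)
    ; symm     = swap
    ; irrefl   = λ { refl (inj₁ e) → lookup loopless e refl
                   ; refl (inj₂ e) → lookup loopless e refl }
    ; vertices = vs
    ; complete = complete
    ; unique   = unique
    }

data GF4 : Set where
  0# 1# α α² : GF4

infixl 6 _+_
infixl 7 _*_
infix  4 _≟_

_+_ : GF4 → GF4 → GF4
0# + y  = y
x  + 0# = x
1# + 1# = 0#
1# + α  = α²
1# + α² = α
α  + 1# = α²
α  + α  = 0#
α  + α² = 1#
α² + 1# = α
α² + α  = 1#
α² + α² = 0#

_*_ : GF4 → GF4 → GF4
0# * _  = 0#
_  * 0# = 0#
1# * y  = y
x  * 1# = x
α  * α  = α²
α  * α² = 1#
α² * α  = 1#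
α² * α² = α

_≟_ : DecidableEquality GF4
0# ≟ 0# = yes refl
0# ≟ 1# = no λ ()
0# ≟ α  = no λ ()
0# ≟ α² = no λ ()
1# ≟ 0# = no λ ()
1# ≟ 1# = yes refl
1# ≟ α  = no λ ()
1# ≟ α² = no λ ()
α  ≟ 0# = no λ ()
α  ≟ 1# = no λ ()
α  ≟ α  = yes refl
α  ≟ α² = no λ ()
α² ≟ 0# = no λ ()
α² ≟ 1# = no λ ()
α² ≟ α  = no λ ()
α² ≟ α² = yes refl

all? : ∀ {P : GF4 → Set} → Decidable₁ P → Dec (∀ x → P x)
all? P? = map′
  (λ { (p , q , r , s) → λ { 0# → p ; 1# → q ; α → r ; α² → s } })
  (λ f → f 0# , f 1# , f α , f α²)
  (P? 0# ×-dec P? 1# ×-dec P? α ×-dec P? α²)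

-- In characteristic two every element is its own additive inverse.
GF4-isCommutativeRing : IsCommutativeRing _≡_ _+_ _*_ id 0# 1#
GF4-isCommutativeRing = record
  { isRing = record
    { +-isAbelianGroup = record
      { isGroup = record
        { isMonoid = record
          { isSemigroup = record
            { isMagma = record
              { isEquivalence = isEquivalence ; ∙-cong = cong₂ _+_ }
            ; assoc = from-yes (all? λ x → all? λ y → all? λ z →
                        x + y + z ≟ x + (y + z))
            }
          ; identity = from-yes (all? λ x → 0# + x ≟ x)
                     , from-yes (all? λ x → x + 0# ≟ x)
          }
        ; inverse = from-yes (all? λ x → x + x ≟ 0#)
                  , from-yes (all? λ x → x + x ≟ 0#)
        ; ⁻¹-cong = id
        }
      ; comm = from-yes (all? λ x → all? λ y → x + y ≟ y + x)
      }
    ; *-cong = cong₂ _*_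
    ; *-assoc = from-yes (all? λ x → all? λ y → all? λ z →
                  x * y * z ≟ x * (y * z))
    ; *-identity = from-yes (all? λ x → 1# * x ≟ x)
                 , from-yes (all? λ x → x * 1# ≟ x)
    ; distrib = from-yes (all? λ x → all? λ y → all? λ z →
                  x * (y + z) ≟ x * y + x * z)
              , from-yes (all? λ x → all? λ y → all? λ z →
                  (y + z) * x ≟ y * x + z * x)
    }
  ; *-comm = from-yes (all? λ x → all? λ y → x * y ≟ y * x)
  }

GF4-inverse : ∀ x → x ≢ 0# → ∃[ y ] x * y ≡ 1#
GF4-inverse 0# x≢0 = contradiction refl x≢0
GF4-inverse 1# _   = 1# , refl
GF4-inverse α  _   = α² , refl
GF4-inverse α² _   = α  , refl

elements : List GF4
elements = 0# ∷ 1# ∷ α ∷ α² ∷ []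

elements-complete : ∀ x → x ∈ elements
elements-complete 0# = here refl
elements-complete 1# = there (here refl)
elements-complete α  = there (there (here refl))
elements-complete α² = there (there (there (here refl)))

elements-unique : Unique elements
elements-unique = from-yes (DecUnique.unique? _≟_ elements)

nonzero? : Decidable₁ (_≢ 0#)
nonzero? x = ¬? (x ≟ 0#)

GF4* : Set
GF4* = [ x ∈ GF4 ∣ x ≢ 0# ]

1* α* α²* : GF4*
1*  = 1# , [ (λ ()) ]
α*  = α  , [ (λ ()) ]
α²* = α² , [ (λ ()) ]

graphOnGF4 : (E : List (GF4 × GF4)) → All (uncurry _≢_) E → Graph
graphOnGF4 = fromEdges _≟_ elements elements-complete elements-unique

graphOnGF4* : (E : List (GF4* × GF4*)) → All (uncurry _≢_) E → Graph
graphOnGF4* = fromEdges (Refinement._≟_ _≟_) (refineList nonzero? elements)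
  (λ v → refineList-complete nonzero? v (elements-complete (value v)))
  (refineList-unique nonzero? elements-unique)

H₁ H₂ G₁ G₂ : Graph
H₁ = graphOnGF4* ((1* , α²*) ∷ (α²* , α*) ∷ []) ((λ ()) ∷ (λ ()) ∷ [])
G₁ = graphOnGF4 ((0# , α) ∷ (1# , α²) ∷ []) ((λ ()) ∷ (λ ()) ∷ [])
H₂ = graphOnGF4 ((α² , 0#) ∷ (0# , 1#) ∷ (1# , α) ∷ [])
                ((λ ()) ∷ (λ ()) ∷ (λ ()) ∷ [])
G₂ = H₂

data V₀⊎V₁ : Set where
  ⟨_,_⟩₀ : (x y : GF4) → V₀⊎V₁
  ⟨_,_⟩₁ : (m b : GF4) → V₀⊎V₁

data Incident : V₀⊎V₁ → V₀⊎V₁ → Set where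
  inc₀₁ : ∀ {x y m b} → y ≡ m * x + b → Incident ⟨ x , y ⟩₀ ⟨ m , b ⟩₁
  inc₁₀ : ∀ {x y m b} → y ≡ m * x + b → Incident ⟨ m , b ⟩₁ ⟨ x , y ⟩₀

incident? : Decidable Incident
incident? ⟨ _ , _ ⟩₀ ⟨ _ , _ ⟩₀ = no λ ()
incident? ⟨ x , y ⟩₀ ⟨ m , b ⟩₁ =
  map′ inc₀₁ (λ { (inc₀₁ e) → e }) (y ≟ m * x + b)
incident? ⟨ m , b ⟩₁ ⟨ x , y ⟩₀ =
  map′ inc₁₀ (λ { (inc₁₀ e) → e }) (y ≟ m * x + b)
incident? ⟨ _ , _ ⟩₁ ⟨ _ , _ ⟩₁ = no λ ()

incident-sym : Symmetric Incident
incident-sym (inc₀₁ e) = inc₁₀ e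
incident-sym (inc₁₀ e) = inc₀₁ e

incident-irrefl : Irreflexive _≡_ Incident
incident-irrefl refl ()

_≟ᵥ_ : DecidableEquality V₀⊎V₁
⟨ x , y ⟩₀ ≟ᵥ ⟨ x′ , y′ ⟩₀ =
  map′ (λ { (refl , refl) → refl }) (λ { refl → refl , refl })
       ((x ≟ x′) ×-dec (y ≟ y′))
⟨ _ , _ ⟩₀ ≟ᵥ ⟨ _ , _ ⟩₁ = no λ ()
⟨ _ , _ ⟩₁ ≟ᵥ ⟨ _ , _ ⟩₀ = no λ ()
⟨ m , b ⟩₁ ≟ᵥ ⟨ m′ , b′ ⟩₁ =
  map′ (λ { (refl , refl) → refl }) (λ { refl → refl , refl })
       ((m ≟ m′) ×-dec (b ≟ b′))

listV₀ listV₁ : List V₀⊎V₁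
listV₀ = cartesianProductWith ⟨_,_⟩₀ elements elements
listV₁ = cartesianProductWith ⟨_,_⟩₁ elements elements

B₄ : Graph
B₄ = record
  { Vertex   = V₀⊎V₁
  ; Adj      = Incident
  ; adj?     = incident?
  ; symm     = incident-sym
  ; irrefl   = incident-irrefl
  ; vertices = listV₀ ++ listV₁
  ; complete = λ
    { ⟨ x , y ⟩₀ → ∈-++⁺ˡ
        (∈-cartesianProductWith⁺ ⟨_,_⟩₀ (elements-complete x) (elements-complete y))
    ; ⟨ m , b ⟩₁ → ∈-++⁺ʳ listV₀
        (∈-cartesianProductWith⁺ ⟨_,_⟩₁ (elements-complete m) (elements-complete b))
    }
  ; unique   = from-yes (DecUnique.unique? _≟ᵥ_ (listV₀ ++ listV₁))
  }

-- The parameters T = ∅ and u₀ = u₁ = 0 of the amalgam delete nothing, so only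
-- S occurs in its construction.
S : Pred GF4 _
S = ｛ 0# ｝

data Deleted : V₀⊎V₁ → Set where
  deleted : ∀ {y} → S y → Deleted ⟨ 0# , y ⟩₀

Kept : V₀⊎V₁ → Set
Kept v = ¬ Deleted v

data NewEdge : V₀⊎V₁ → V₀⊎V₁ → Set where
  h₁ : ∀ {u v p q} → Adj H₁ (u , p) (v , q) → NewEdge ⟨ 0# , u ⟩₀ ⟨ 0# , v ⟩₀
  h₂ : ∀ {u v} → Adj H₂ u v → NewEdge ⟨ 0# , u ⟩₁ ⟨ 0# , v ⟩₁
  g₁ : ∀ {x u v} → x ≢ 0# → Adj G₁ u v → NewEdge ⟨ x , u ⟩₀ ⟨ x , v ⟩₀
  g₂ : ∀ {m u v} → m ≢ 0# → Adj G₂ u v → NewEdge ⟨ m , u ⟩₁ ⟨ m , v ⟩₁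

deleted? : Decidable₁ Deleted
deleted? ⟨ 0# , y ⟩₀ = map′ deleted (λ { (deleted s) → s }) (0# ≟ y)
deleted? ⟨ 1# , _ ⟩₀ = no λ ()
deleted? ⟨ α  , _ ⟩₀ = no λ ()
deleted? ⟨ α² , _ ⟩₀ = no λ ()
deleted? ⟨ _  , _ ⟩₁ = no λ ()

kept? : Decidable₁ Kept
kept? v = ¬? (deleted? v)

newEdge-sym : Symmetric NewEdge
newEdge-sym (h₁ e)     = h₁ (symm H₁ e)
newEdge-sym (h₂ e)     = h₂ (symm H₂ e)
newEdge-sym (g₁ x≢0 e) = g₁ x≢0 (symm G₁ e)
newEdge-sym (g₂ m≢0 e) = g₂ m≢0 (symm G₂ e)

newEdge-irrefl : Irreflexive _≡_ NewEdge
newEdge-irrefl refl (h₁ e)   = irrefl H₁ refl e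
newEdge-irrefl refl (h₂ e)   = irrefl H₂ refl e
newEdge-irrefl refl (g₁ _ e) = irrefl G₁ refl e
newEdge-irrefl refl (g₂ _ e) = irrefl G₂ refl e

newEdge? : Decidable NewEdge
newEdge? ⟨ x , u ⟩₀ ⟨ x′ , v ⟩₀ with x ≟ x′
... | no x≢x′ = no λ { (h₁ _) → x≢x′ refl ; (g₁ _ _) → x≢x′ refl }
... | yes refl with x ≟ 0#
...   | no x≢0 =
        map′ (g₁ x≢0) (λ { (h₁ _) → contradiction refl x≢0 ; (g₁ _ e) → e })
             (adj? G₁ u v)
...   | yes refl with u ≟ 0# | v ≟ 0#
...     | no u≢0 | no v≢0 =
          map′ (h₁ {p = [ u≢0 ]} {q = [ v≢0 ]})
               (λ { (h₁ e) → e ; (g₁ 0≢0 _) → contradiction refl 0≢0 })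
               (adj? H₁ (u , [ u≢0 ]) (v , [ v≢0 ]))
...     | yes refl | _ =
          no λ { (h₁ {p = [ 0≢0 ]} _) → ⊥-elim-irr (0≢0 refl)
               ; (g₁ 0≢0 _) → 0≢0 refl }
...     | no _ | yes refl =
          no λ { (h₁ {q = [ 0≢0 ]} _) → ⊥-elim-irr (0≢0 refl)
               ; (g₁ 0≢0 _) → 0≢0 refl }
newEdge? ⟨ _ , _ ⟩₀ ⟨ _ , _ ⟩₁ = no λ ()
newEdge? ⟨ _ , _ ⟩₁ ⟨ _ , _ ⟩₀ = no λ ()
newEdge? ⟨ m , u ⟩₁ ⟨ m′ , v ⟩₁ with m ≟ m′
... | no m≢m′ = no λ { (h₂ _) → m≢m′ refl ; (g₂ _ _) → m≢m′ refl }
... | yes refl with m ≟ 0#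
...   | no m≢0 =
        map′ (g₂ m≢0) (λ { (h₂ _) → contradiction refl m≢0 ; (g₂ _ e) → e })
             (adj? G₂ u v)
...   | yes refl =
        map′ h₂ (λ { (h₂ e) → e ; (g₂ 0≢0 _) → contradiction refl 0≢0 })
             (adj? H₂ u v)

-- The amalgam B*₄(S,T,u₀,u₁).
B₄* : Graph
B₄* = record
  { Vertex   = [ v ∈ Vertex B₄ ∣ Kept v ]
  ; Adj      = λ v w → Adj B₄ (value v) (value w) ⊎ NewEdge (value v) (value w)
  ; adj?     = λ v w → adj? B₄ (value v) (value w)
                       ⊎-dec newEdge? (value v) (value w)
  ; symm     = Sum.map (symm B₄) newEdge-sym
  ; irrefl   = λ { refl → Sum.[ irrefl B₄ refl , newEdge-irrefl refl ] }
  ; vertices = refineList kept? (vertices B₄)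
  ; complete = λ v → refineList-complete kept? v (complete B₄ (value v))
  ; unique   = refineList-unique kept? (unique B₄)
  }

{-# OPTIONS --safe #-}

-- The lower bound is the Moore bound: in a graph of girth at least 5 a vertex
-- of degree 6, its neighbours, and the at least four further neighbours of each
-- of these are pairwise distinct, so there are at least 1 + 6 + 6 · 4 = 31
-- vertices. The degrees and the girth of the amalgam are checked by exhaustive
-- search, using that girth at least 5 means that there are no triangles and
-- that distinct vertices have at most one common neighbour.
module Submission where

open import Defs
open import Data.Fin using (Fin; zero; suc; toℕ)
open import Data.Fin.Patterns using (0F; 1F; 2F; 3F; 4F)
open import Data.Fin.Properties using (injective⇒≤; inj⇒≟)
open import Data.Irrelevant using ([_])
open import Data.List
  using (List; []; _∷_; _++_; length; filter; concatMap; lookup)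
open import Data.List.Membership.Propositional using (_∈_; find)
open import Data.List.Membership.Propositional.Properties
  using (∈-filter⁺; ∈-filter⁻; ∈-concatMap⁻; ∈-lookup)
open import Data.List.Membership.Setoid.Properties using (index-injective)
open import Data.List.Properties using (length-++)
open import Data.List.Relation.Binary.Disjoint.Propositional using (Disjoint)
open import Data.List.Relation.Binary.Subset.Propositional using (_⊆_)
open import Data.List.Relation.Unary.All as All using (All; []; _∷_)
import Data.List.Relation.Unary.All.Properties as All
open import Data.List.Relation.Unary.AllPairs using (AllPairs; []; _∷_)
import Data.List.Relation.Unary.AllPairs.Properties as AllPairs
open import Data.List.Relation.Unary.Any using (here; there; index)
open import Data.List.Relation.Unary.Linked using (Linked; [-]; _∷_; linked?)
open import Data.List.Relation.Unary.Unique.Propositional using (Unique)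
open import Data.List.Relation.Unary.Unique.Propositional.Properties
  using (++⁺; concat⁺; filter⁺)
import Data.List.Relation.Unary.Unique.DecPropositional as DecUnique
open import Data.Nat as ℕ using (ℕ; suc; _≤_; z≤n; s≤s; s≤s⁻¹)
open import Data.Nat.Properties as ℕ
  using (+-mono-≤; +-monoʳ-≤; ≤-reflexive; ≤-trans)
open import Data.Product using (∃-syntax; _×_; _,_; proj₂)
open import Data.Refinement as Refinement using (_,_)
open import Data.Sum using (_⊎_; inj₁; inj₂)
open import Function using (_∘_)
open import Function.Bundles using (Equivalence; mk⇔)
open import Function.Definitions using (Injective)
open import Relation.Binary.Definitions using (DecidableEquality)
open import Relation.Binary.PropositionalEquality
  using (_≡_; _≢_; refl; sym; cong; subst; setoid; ≢-sym)
open import Relation.Nullary using (¬_; Dec; yes; no)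
open import Relation.Nullary.Decidable
  using (True; toWitness; map′; from-yes; ¬?; _⊎-dec_; _→-dec_)
open import Relation.Nullary.Negation using (contradiction)
open import Relation.Unary using () renaming (Decidable to Decidable₁)

open Graph

private
  variable
    A B : Set
    G   : Graph

-- Duplicate-free lists and lists of consecutive pairs.

lookup-injective : {xs : List A} → Unique xs → Injective _≡_ _≡_ (lookup xs)
lookup-injective (_  ∷ _)   {zero}  {zero}  _  = refl
lookup-injective (x# ∷ _)   {zero}  {suc j} eq =
  contradiction eq (All.lookup x# (∈-lookup j))
lookup-injective (x# ∷ _)   {suc i} {zero}  eq =
  contradiction (sym eq) (All.lookup x# (∈-lookup i))
lookup-injective (_  ∷ xs!) {suc i} {suc j} eq =
  cong suc (lookup-injective xs! eq)

-- Sending each position in `xs` to a position of the same element in `ys` is injective.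
unique-⊆⇒length≤ : {xs ys : List A} → Unique xs → xs ⊆ ys →
                   length xs ≤ length ys
unique-⊆⇒length≤ {xs = xs} xs! xs⊆ys =
  injective⇒≤ {f = λ i → index (xs⊆ys (∈-lookup {xs = xs} i))}
    (lookup-injective xs! ∘ index-injective (setoid _) _ _)

length-concatMap-≥ : (f : A → List B) {k : ℕ} {xs : List A} →
                     All (λ x → k ≤ length (f x)) xs →
                     length xs ℕ.* k ≤ length (concatMap f xs)
length-concatMap-≥ f []                    = z≤n
length-concatMap-≥ f (_∷_ {x = x} k≤ k≤xs) =
  ≤-trans (+-mono-≤ k≤ (length-concatMap-≥ f k≤xs))
          (≤-reflexive (sym (length-++ (f x))))

-- The implication may use membership in `xs`, since disjointness of children is proved only for
-- neighbours of the root.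
∈-mapAllPairs : {R S : A → A → Set} {xs : List A} →
                (∀ {x y} → x ∈ xs → y ∈ xs → R x y → S x y) →
                AllPairs R xs → AllPairs S xs
∈-mapAllPairs f []         = []
∈-mapAllPairs f (rx ∷ rxs) =
  All.tabulate (λ y∈ → f (here refl) (there y∈) (All.lookup rx y∈))
  ∷ ∈-mapAllPairs (λ x∈ y∈ → f (there x∈) (there y∈)) rxs

linked⇒lookup : {R : A → A → Set} {xs : List A} → Linked R xs →
                ∀ i j → toℕ j ≡ suc (toℕ i) → R (lookup xs i) (lookup xs j)
linked⇒lookup (r ∷ _)  zero    (suc zero) refl = r
linked⇒lookup (_ ∷ rs) (suc i) (suc j)    eq   =
  linked⇒lookup rs i j (cong ℕ.pred eq)

-- Girth at least 5 in terms of triangles and quadrangles.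

TriangleFree : Graph → Set
TriangleFree G = ∀ a b c → Adj G a b → Adj G b c → ¬ Adj G c a

-- Each hypothesis directly follows the vertices it mentions, so that an exhaustive check ranges
-- over `d` only for distinct `a`, `c` with a common neighbour `b`.
QuadrangleFree : Graph → Set
QuadrangleFree G = ∀ a c → a ≢ c →
  ∀ b → Adj G a b → Adj G c b → ∀ d → Adj G a d → Adj G c d → b ≡ d

adj⇒≢ : ∀ (G : Graph) {v w} → Adj G v w → v ≢ w
adj⇒≢ G e refl = irrefl G refl e

-- An arbitrary `Graph` carries no equality test; vertices are compared through the positions that
-- `complete` gives them.
vertex≟ : (G : Graph) → DecidableEquality (Vertex G)
vertex≟ G = inj⇒≟ {S = setoid (Vertex G)} record
  { to        = λ v → index (complete G v)
  ; cong      = cong λ v → index (complete G v)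
  ; injective = index-injective (setoid (Vertex G)) _ _
  }

∀? : (G : Graph) {P : Vertex G → Set} → Decidable₁ P → Dec (∀ v → P v)
∀? G P? = map′ (λ ps v → All.lookup ps (complete G v)) (λ p → All.universal p _)
               (All.all? P? (vertices G))

girth≥5⇒triangleFree : (∀ k → Cycle G k → 5 ≤ k) → TriangleFree G
girth≥5⇒triangleFree {G} girth≥5 a b c ab bc ca =
  contradiction (girth≥5 3 triangle) (λ { (s≤s (s≤s (s≤s ()))) })
  where
  triangle : Cycle G 3
  triangle = record
    { 3≤k         = ℕ.≤-refl
    ; at          = lookup (a ∷ b ∷ c ∷ [])
    ; injective   = lookup-injective
        ((adj⇒≢ G ab ∷ ≢-sym (adj⇒≢ G ca) ∷ []) ∷ (adj⇒≢ G bc ∷ []) ∷ [] ∷ [])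
    ; consecutive = linked⇒lookup {R = Adj G} (ab ∷ bc ∷ [-])
    ; closing     = λ { 2F 0F refl refl → ca }
    }

-- If `b` and `d` differed, `a b c d` would be a 4-cycle: adjacency separates consecutive vertices,
-- and `a≢c` and `b≢d` separate the opposite ones.
girth≥5⇒quadrangleFree : (∀ k → Cycle G k → 5 ≤ k) → QuadrangleFree G
girth≥5⇒quadrangleFree {G} girth≥5 a c a≢c b ab cb d ad cd with vertex≟ G b d
... | yes b≡d = b≡d
... | no  b≢d =
  contradiction (girth≥5 4 quadrangle) (λ { (s≤s (s≤s (s≤s (s≤s ())))) })
  where
  quadrangle : Cycle G 4
  quadrangle = record
    { 3≤k         = ℕ.n≤1+n 3
    ; at          = lookup (a ∷ b ∷ c ∷ d ∷ [])
    ; injective   = lookup-injective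
        ( (adj⇒≢ G ab ∷ a≢c ∷ adj⇒≢ G ad ∷ [])
        ∷ (≢-sym (adj⇒≢ G cb) ∷ b≢d ∷ []) ∷ (adj⇒≢ G cd ∷ []) ∷ [] ∷ [])
    ; consecutive = linked⇒lookup {R = Adj G} (ab ∷ symm G cb ∷ cd ∷ [-])
    ; closing     = λ { 3F 0F refl refl → symm G ad }
    }

free⇒girth≥5 : TriangleFree G → QuadrangleFree G → ∀ k → Cycle G k → 5 ≤ k
free⇒girth≥5 _ _ 0 C = contradiction (Cycle.3≤k C) λ ()
free⇒girth≥5 _ _ 1 C = contradiction (Cycle.3≤k C) λ { (s≤s ()) }
free⇒girth≥5 _ _ 2 C = contradiction (Cycle.3≤k C) λ { (s≤s (s≤s ())) }
free⇒girth≥5 triangleFree _ 3 C =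
  contradiction (closing 2F 0F refl refl)
    (triangleFree _ _ _ (consecutive 0F 1F refl) (consecutive 1F 2F refl))
  where open Cycle C
free⇒girth≥5 {G} _ quadrangleFree 4 C =
  contradiction (injective at1≡at3) λ ()
  where
  open Cycle C
  -- Vertices 1 and 3 of the 4-cycle are both common neighbours of the opposite vertices 0 and 2.
  at1≡at3 : at 1F ≡ at 3F
  at1≡at3 = quadrangleFree (at 0F) (at 2F)
    (λ eq → contradiction (injective eq) λ ())
    (at 1F) (consecutive 0F 1F refl) (symm G (consecutive 1F 2F refl))
    (at 3F) (symm G (closing 3F 0F refl refl)) (consecutive 2F 3F refl)
free⇒girth≥5 _ _ (suc (suc (suc (suc (suc k))))) _ =
  s≤s (s≤s (s≤s (s≤s (s≤s z≤n))))

-- The Moore bound.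

module MooreBound (G : Graph) (triangleFree : TriangleFree G)
                  (quadrangleFree : QuadrangleFree G) where

  -- `degree G v` is by definition the length of this list.
  neighbours : Vertex G → List (Vertex G)
  neighbours v = filter (adj? G v) (vertices G)

  neighbours-unique : ∀ v → Unique (neighbours v)
  neighbours-unique v = filter⁺ (adj? G v) (unique G)

  ∈-neighbours⁻ : ∀ {v w} → w ∈ neighbours v → Adj G v w
  ∈-neighbours⁻ {v} = proj₂ ∘ ∈-filter⁻ (adj? G v) {xs = vertices G}

  module _ (v : Vertex G) where

    ≢v? : Decidable₁ (_≢ v)
    ≢v? x = ¬? (vertex≟ G x v)

    children : Vertex G → List (Vertex G)
    children w = filter ≢v? (neighbours w)

    ∈-children⁻ : ∀ {w x} → x ∈ children w → Adj G w x × x ≢ v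
    ∈-children⁻ {w} x∈ with ∈-filter⁻ ≢v? {xs = neighbours w} x∈
    ... | x∈w , x≢v = ∈-neighbours⁻ x∈w , x≢v

    -- Filtering removes only `v`, which occurs at most once; hence `w` need not be adjacent to `v`.
    degree≤1+children : ∀ w → degree G w ≤ suc (length (children w))
    degree≤1+children w = unique-⊆⇒length≤ (neighbours-unique w) λ {x} x∈ →
      lemma x x∈ (vertex≟ G x v)
      where
      lemma : ∀ x → x ∈ neighbours w → Dec (x ≡ v) → x ∈ v ∷ children w
      lemma x x∈ (yes x≡v) = here x≡v
      lemma x x∈ (no  x≢v) = there (∈-filter⁺ ≢v? x∈ x≢v)

    grandchildren : List (Vertex G)
    grandchildren = concatMap children (neighbours v)

    ball : List (Vertex G)
    ball = v ∷ neighbours v ++ grandchildren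

    -- A child `x` shared by distinct neighbours `w`, `w′` of `v` would give the distinct vertices
    -- `v` and `x` two common neighbours.
    grandchildren-unique : Unique grandchildren
    grandchildren-unique = concat⁺
      (All.map⁺ (All.universal (λ w → filter⁺ ≢v? (neighbours-unique w)) _))
      (AllPairs.map⁺ (∈-mapAllPairs disjoint (neighbours-unique v)))
      where
      disjoint : ∀ {w w′} → w ∈ neighbours v → w′ ∈ neighbours v → w ≢ w′ →
                 Disjoint (children w) (children w′)
      disjoint {w} {w′} w∈ w′∈ w≢w′ (x∈ , x∈′)
        with ∈-children⁻ x∈ | ∈-children⁻ x∈′
      ... | wx , x≢v | w′x , _ = w≢w′ (quadrangleFree v _ (≢-sym x≢v)
        w (∈-neighbours⁻ w∈) (symm G wx) w′ (∈-neighbours⁻ w′∈) (symm G w′x))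

    grandchildren⁻ : ∀ {P : Vertex G → Set} →
                     (∀ {w x} → Adj G v w → Adj G w x → x ≢ v → P x) →
                     ∀ {x} → x ∈ grandchildren → P x
    grandchildren⁻ f x∈ with find (∈-concatMap⁻ children {xs = neighbours v} x∈)
    ... | w , w∈ , x∈w with ∈-children⁻ x∈w
    ...   | wx , x≢v = f (∈-neighbours⁻ w∈) wx x≢v

    -- The root is not its own neighbour and is filtered out of the children; a neighbour that is
    -- also a grandchild would close a triangle through `v`.
    ball-unique : Unique ball
    ball-unique =
      All.++⁺ (All.tabulate (adj⇒≢ G ∘ ∈-neighbours⁻))
              (All.tabulate (grandchildren⁻ λ _ _ → ≢-sym))
      ∷ ++⁺ (neighbours-unique v) grandchildren-unique
            (λ { (x∈ , x∈′) → grandchildren⁻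
                 (λ vw wx _ vx → triangleFree _ _ _ vw wx (symm G vx))
                 x∈′ (∈-neighbours⁻ x∈) })

    -- Writing the lower bound on degrees as `suc k` leaves at least `k` children for each
    -- neighbour, without subtraction.
    moore-bound : ∀ {k} → (∀ w → suc k ≤ degree G w) →
                  suc (degree G v ℕ.+ degree G v ℕ.* k) ≤ order G
    moore-bound {k} 1+k≤degree = begin
      suc (degree G v ℕ.+ degree G v ℕ.* k)
        ≤⟨ s≤s (+-monoʳ-≤ (degree G v)
             (length-concatMap-≥ children {xs = neighbours v} (All.universal
               (λ w → s≤s⁻¹ (≤-trans (1+k≤degree w) (degree≤1+children w))) _))) ⟩
      suc (degree G v ℕ.+ length grandchildren)
        ≡⟨ cong suc (length-++ (neighbours v)) ⟨
      length ball
        ≤⟨ unique-⊆⇒length≤ ball-unique (λ _ → complete G _) ⟩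
      order G ∎
      where open ℕ.≤-Reasoning

biregular-56-order≥31 : ∀ H → IsBiregularGraph 5 6 5 H → 31 ≤ order H
biregular-56-order≥31 H H-biregular =
  -- The root must have degree 6, which is attained; a root of degree 5 would give only 26.
  bound (Equivalence.from (degrees 6) (inj₂ refl))
  where
  open IsBiregularGraph H-biregular
  open MooreBound H (girth≥5⇒triangleFree (proj₂ girth))
                    (girth≥5⇒quadrangleFree (proj₂ girth))

  5≤degree : ∀ w → 5 ≤ degree H w
  5≤degree w with Equivalence.to (degrees _) (w , refl)
  ... | inj₁ eq = ≤-reflexive (sym eq)
  ... | inj₂ eq = ≤-trans (ℕ.n≤1+n 5) (≤-reflexive (sym eq))

  bound : (∃[ v ] degree H v ≡ 6) → 31 ≤ order H
  bound (v , eq) = subst (λ d → suc (d ℕ.+ d ℕ.* 4) ≤ order H) eq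
                         (moore-bound v 5≤degree)

-- Degrees and girth of the amalgam.

B₄*-vertex≟ : DecidableEquality (Vertex B₄*)
B₄*-vertex≟ = Refinement._≟_ _≟ᵥ_

B₄*-degrees : ∀ v → degree B₄* v ≡ 5 ⊎ degree B₄* v ≡ 6
B₄*-degrees = from-yes (∀? B₄* λ v →
  (degree B₄* v ℕ.≟ 5) ⊎-dec (degree B₄* v ℕ.≟ 6))

B₄*-triangleFree : TriangleFree B₄*
B₄*-triangleFree = from-yes
  (∀? B₄* λ a → ∀? B₄* λ b → ∀? B₄* λ c →
   adj? B₄* a b →-dec adj? B₄* b c →-dec ¬? (adj? B₄* c a))

B₄*-quadrangleFree : QuadrangleFree B₄*
B₄*-quadrangleFree = from-yes
  (∀? B₄* λ a → ∀? B₄* λ c → ¬? (B₄*-vertex≟ a c) →-dec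
   ∀? B₄* λ b → adj? B₄* a b →-dec adj? B₄* c b →-dec
   ∀? B₄* λ d → adj? B₄* a d →-dec adj? B₄* c d →-dec B₄*-vertex≟ b d)

keep : (v : V₀⊎V₁) → {True (kept? v)} → Vertex B₄*
keep v {p} = v , [ toWitness p ]

B₄*-5-cycle : Cycle B₄* 5
B₄*-5-cycle = record
  { 3≤k         = s≤s (s≤s (s≤s z≤n))
  ; at          = lookup walk
  ; injective   = lookup-injective (from-yes (DecUnique.unique? B₄*-vertex≟ walk))
  ; consecutive = linked⇒lookup (from-yes (linked? (adj? B₄*) walk))
  ; closing     = λ { 4F 0F refl refl →
      from-yes (adj? B₄* (lookup walk 4F) (lookup walk 0F)) }
  }
  where
  -- The path 1, `α²`, `α` of `H₁` and the edge from `α` to 1 of `H₂`, joined by incidences of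
  -- `⟨ 0# , b ⟩₀` with `⟨ 0# , b ⟩₁`, which hold as b = 0 · 0 + b.
  walk : List (Vertex B₄*)
  walk = keep ⟨ 0# , 1# ⟩₀ ∷ keep ⟨ 0# , α² ⟩₀ ∷ keep ⟨ 0# , α ⟩₀
       ∷ keep ⟨ 0# , α ⟩₁ ∷ keep ⟨ 0# , 1# ⟩₁ ∷ []

B₄*-isBiregularGraph : IsBiregularGraph 5 6 5 B₄*
B₄*-isBiregularGraph = record
  { degrees = λ d → mk⇔
      (λ { (v , refl) → B₄*-degrees v })
      -- Both witnesses keep their four incidences; 0 has one neighbour in `G₁`, while 1 has two in
      -- `H₂`.
      (λ { (inj₁ refl) → keep ⟨ 1# , 0# ⟩₀ , refl
         ; (inj₂ refl) → keep ⟨ 0# , 1# ⟩₁ , refl })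
  ; girth   = B₄*-5-cycle , free⇒girth≥5 B₄*-triangleFree B₄*-quadrangleFree
  }

theorem6p1 : IsBiregularCage 5 6 5 B₄* × Graph.order B₄* ≡ 31
theorem6p1 =
  -- `order B₄*` evaluates to 31, the 32 vertices of `B₄` less the deleted one, so the lower bound
  -- has the type of `minimal` as it stands.
  record { isBiregularGraph = B₄*-isBiregularGraph ; minimal = biregular-56-order≥31 }
  , refl
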